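{- Let $G$ be a connected graph on $n \geq 2$ vertices. Then $\mathcal{D}(G)$ is Eulerian if and only if $n$ is even and $G$ is the cocktail party graph on $n \geq 4$ vertices.
   Context: All graphs are finite and simple. A dominating set of a graph $G$ is a set $D \subseteq V(G)$ such that every vertex of $V(G)\setminus D$ is adjacent to a vertex of $D$. The dominating graph $\mathcal{D}(G)$ is the graph whose vertices are all the dominating sets of $G$ (of any cardinality), two of them being adjacent if and only if one can be obtained from the other by adding or removing a single vertex of $G$. A graph is Eulerian if and only if every vertex has even degree and it contains at most one non-trivial component (a graph or component is trivial if it contains no edges). For an even integer $n \geq 4$, the cocktail party graph on $n$ vertices is the graph obtained by removing a perfect matching from the complete graph $K_n$ (identification of graphs is up to isomorphism). -}

module Defs where

open import Data.Empty using (⊥-elim; ⊥-elim-irr)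
open import Data.Fin.Base using (Fin; zero; suc)
open import Data.Fin.Properties using (_≟_; all?; any?)
open import Data.Fin.Subset
  using (Subset; inside; outside; _∈_; _∉_; _∪_; _-_; ⁅_⁆)
open import Data.Fin.Subset.Properties
  using (_∈?_; p─⊥≡p; ∪-identityʳ; x∈⁅x⁆; x∈p∪q⁺)
open import Data.List.Base using (List; []; _∷_; map; _++_; length; filter)
import Data.List.Membership.Propositional as List
open import Data.List.Membership.Propositional.Properties
  using (∈-map⁺; ∈-map⁻; ∈-++⁺ˡ; ∈-++⁺ʳ)
open import Data.List.Relation.Unary.All using (All; []; _∷_)
open import Data.List.Relation.Unary.AllPairs using ([]; _∷_)
open import Data.List.Relation.Unary.Any using (here; there)
open import Data.List.Relation.Unary.Unique.Propositional using (Unique)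
import Data.List.Relation.Unary.Unique.Propositional.Properties as Unique
open import Data.Nat.Base using (ℕ; zero; suc)
open import Data.Nat.Divisibility using (_∣_)
open import Data.Product using (Σ; ∃-syntax; ∃!; _×_; _,_)
open import Data.Sum.Base using (_⊎_; inj₁; inj₂)
open import Data.Vec.Base using ([]; _∷_; here; there)
open import Data.Vec.Properties using (∷-injectiveʳ; ≡-dec)
import Data.Bool.Properties as Bool
open import Function.Base using (_∘_)
open import Function.Bundles using (_↔_; _⇔_; Inverse)
open import Level using (0ℓ)
open import Relation.Binary.Construct.Closure.ReflexiveTransitive using (Star)
open import Relation.Binary.Core using (Rel)
open import Relation.Binary.Definitions using (Symmetric; Irreflexive; Decidable)
open import Relation.Binary.PropositionalEquality
  using (_≡_; _≢_; refl; sym; trans; cong; subst; ≢-sym)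
open import Relation.Nullary using (¬_; yes; no; ¬?; _×-dec_; _→-dec_; _⊎-dec_)
import Relation.Unary
open import Relation.Unary using (Pred; _≐_)

private
  variable
    n : ℕ
    V W : Set

record Finite (V : Set) : Set where
  field
    elements : List V
    unique   : Unique elements
    complete : ∀ v → v List.∈ elements

record SimpleGraph (V : Set) : Set₁ where
  field
    Adj    : Rel V 0ℓ
    Adj?   : Decidable Adj
    symm   : Symmetric Adj
    irrefl : Irreflexive _≡_ Adj

open SimpleGraph public

degree : {{Finite V}} → SimpleGraph V → V → ℕ
degree {{fin}} G v = length (filter (Adj? G v) (Finite.elements fin))

Reachable : SimpleGraph V → Rel V 0ℓ
Reachable G = Star (Adj G)

Connected : SimpleGraph V → Set
Connected G = ∀ u v → Reachable G u v

Component : SimpleGraph V → V → Pred V 0ℓ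
Component G v w = Reachable G v w

NonTrivial : SimpleGraph V → Pred V 0ℓ → Set
NonTrivial G C = ∃[ u ] ∃[ v ] C u × C v × Adj G u v

AtMostOneNonTrivialComponent : SimpleGraph V → Set
AtMostOneNonTrivialComponent G =
  ∀ u v → NonTrivial G (Component G u) → NonTrivial G (Component G v) →
  Component G u ≐ Component G v

Eulerian : {{Finite V}} → SimpleGraph V → Set
Eulerian G = (∀ v → 2 ∣ degree G v) × AtMostOneNonTrivialComponent G

record _≅_ (G : SimpleGraph V) (H : SimpleGraph W) : Set where
  field
    bijection : V ↔ W
    adjacency : ∀ u v →
      Adj G u v ⇔ Adj H (Inverse.to bijection u) (Inverse.to bijection v)

complete : ∀ n → SimpleGraph (Fin n)
complete n .Adj            = _≢_
complete n .Adj? u v       = ¬? (u ≟ v)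
complete n .symm           = ≢-sym
complete n .irrefl u≡v u≢v = u≢v u≡v

-- A set of edges is represented by the spanning subgraph it forms; it is a
-- perfect matching when every vertex is incident to exactly one of its edges.
record PerfectMatching (G : SimpleGraph V) : Set₁ where
  field
    edges    : SimpleGraph V
    subgraph : ∀ {u v} → Adj edges u v → Adj G u v
    perfect  : ∀ u → ∃! _≡_ (Adj edges u)

removeMatching : (G : SimpleGraph V) → PerfectMatching G → SimpleGraph V
removeMatching G M = λ where
    .Adj u v                  → Adj G u v × ¬ Adj edges u v
    .Adj? u v                 → Adj? G u v ×-dec ¬? (Adj? edges u v)
    .symm (uv∈G , uv∉M)       → symm G uv∈G , uv∉M ∘ symm edges
    .irrefl u≡v (uv∈G , uv∉M) → irrefl G u≡v uv∈G
  where open PerfectMatching M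

IsCocktailParty : SimpleGraph (Fin n) → Set₁
IsCocktailParty {n} G =
  Σ (PerfectMatching (complete n)) λ M → G ≅ removeMatching (complete n) M

Dominating : SimpleGraph (Fin n) → Pred (Subset n) 0ℓ
Dominating G D = ∀ v → v ∉ D → ∃[ u ] u ∈ D × Adj G v u

dominating? : (G : SimpleGraph (Fin n)) → Relation.Unary.Decidable (Dominating G)
dominating? G D =
  all? λ v → ¬? (v ∈? D) →-dec any? λ u → (u ∈? D) ×-dec Adj? G v u

-- The proof is irrelevant, so that each dominating set occurs exactly once as a
-- vertex of the dominating graph.
record DominatingSet (G : SimpleGraph (Fin n)) : Set where
  constructor _,_
  field
    set         : Subset n
    .dominating : Dominating G set

open DominatingSet public using (set)

OneVertexChange : Rel (Subset n) 0ℓ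
OneVertexChange D E =
  ∃[ x ] (x ∉ D × E ≡ D ∪ ⁅ x ⁆ ⊎ x ∈ D × E ≡ D - x)

oneVertexChange? : Decidable (OneVertexChange {n})
oneVertexChange? D E = any? λ x →
  (¬? (x ∈? D) ×-dec ≡-dec Bool._≟_ E (D ∪ ⁅ x ⁆)) ⊎-dec
  ((x ∈? D) ×-dec ≡-dec Bool._≟_ E (D - x))

x∉p-x : ∀ (p : Subset n) x → x ∉ p - x
x∉p-x (inside  ∷ p) (suc x) (there h) = x∉p-x p x h
x∉p-x (outside ∷ p) (suc x) (there h) = x∉p-x p x h

p∪x-x≡p : ∀ (p : Subset n) x → x ∉ p → (p ∪ ⁅ x ⁆) - x ≡ p
p∪x-x≡p (inside  ∷ p) zero    x∉p = ⊥-elim (x∉p here)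
p∪x-x≡p (outside ∷ p) zero    x∉p = cong (outside ∷_) (trans (p─⊥≡p _) (∪-identityʳ p))
p∪x-x≡p (inside  ∷ p) (suc x) x∉p = cong (inside ∷_) (p∪x-x≡p p x (x∉p ∘ there))
p∪x-x≡p (outside ∷ p) (suc x) x∉p = cong (outside ∷_) (p∪x-x≡p p x (x∉p ∘ there))

p-x∪x≡p : ∀ (p : Subset n) x → x ∈ p → (p - x) ∪ ⁅ x ⁆ ≡ p
p-x∪x≡p (inside  ∷ p) zero    here        = cong (inside ∷_) (trans (∪-identityʳ _) (p─⊥≡p p))
p-x∪x≡p (inside  ∷ p) (suc x) (there x∈p) = cong (inside ∷_) (p-x∪x≡p p x x∈p)
p-x∪x≡p (outside ∷ p) (suc x) (there x∈p) = cong (outside ∷_) (p-x∪x≡p p x x∈p)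

oneVertexChange-sym : Symmetric (OneVertexChange {n})
oneVertexChange-sym {x = D} (x , inj₁ (x∉D , refl)) =
  x , inj₂ (x∈p∪q⁺ (inj₂ (x∈⁅x⁆ x)) , sym (p∪x-x≡p D x x∉D))
oneVertexChange-sym {x = D} (x , inj₂ (x∈D , refl)) =
  x , inj₁ (x∉p-x D x , sym (p-x∪x≡p D x x∈D))

oneVertexChange-irrefl : {D : Subset n} → ¬ OneVertexChange D D
oneVertexChange-irrefl (x , inj₁ (x∉D , D≡D∪x)) =
  x∉D (subst (x ∈_) (sym D≡D∪x) (x∈p∪q⁺ (inj₂ (x∈⁅x⁆ x))))
oneVertexChange-irrefl {D = D} (x , inj₂ (x∈D , D≡D-x)) =
  x∉p-x D x (subst (x ∈_) D≡D-x x∈D)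

𝒟 : (G : SimpleGraph (Fin n)) → SimpleGraph (DominatingSet G)
𝒟 G .Adj D E  = OneVertexChange (set D) (set E)
𝒟 G .Adj? D E = oneVertexChange? (set D) (set E)
𝒟 G .symm     = oneVertexChange-sym
𝒟 G .irrefl refl = oneVertexChange-irrefl

subsets : ∀ n → List (Subset n)
subsets zero    = [] ∷ []
subsets (suc n) = map (inside ∷_) (subsets n) ++ map (outside ∷_) (subsets n)

subsets-complete : (p : Subset n) → p List.∈ subsets n
subsets-complete []            = here refl
subsets-complete (inside  ∷ p) = ∈-++⁺ˡ (∈-map⁺ (inside ∷_) (subsets-complete p))
subsets-complete (outside ∷ p) =
  ∈-++⁺ʳ (map (inside ∷_) (subsets _)) (∈-map⁺ (outside ∷_) (subsets-complete p))

subsets-unique : ∀ n → Unique (subsets n)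
subsets-unique zero    = [] ∷ []
subsets-unique (suc n) = Unique.++⁺
  (Unique.map⁺ ∷-injectiveʳ (subsets-unique n))
  (Unique.map⁺ ∷-injectiveʳ (subsets-unique n))
  λ (p∈ , p∈′) → disjoint (∈-map⁻ (inside ∷_) p∈) (∈-map⁻ (outside ∷_) p∈′)
  where
  disjoint : ∀ {p : Subset (suc n)} {ps} →
             (∃[ q ] q List.∈ ps × p ≡ inside ∷ q) →
             ¬ (∃[ q ] q List.∈ ps × p ≡ outside ∷ q)
  disjoint (_ , _ , refl) (_ , _ , ())

module _ (G : SimpleGraph (Fin n)) where

  restrict : List (Subset n) → List (DominatingSet G)
  restrict []       = []
  restrict (p ∷ ps) with dominating? G p
  ... | yes d = (p , d) ∷ restrict ps
  ... | no  _ = restrict ps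

  restrict-complete : ∀ {ps} (D : DominatingSet G) →
                      set D List.∈ ps → D List.∈ restrict ps
  restrict-complete {p ∷ ps} (D , d) D∈ps with dominating? G p | D∈ps
  ... | yes _ | here refl = here refl
  ... | yes _ | there i   = there (restrict-complete (D , d) i)
  ... | no ¬d | here refl = ⊥-elim-irr (¬d d)
  ... | no _  | there i   = restrict-complete (D , d) i

  restrict-≢ : ∀ {ps} (D : DominatingSet G) →
               All (set D ≢_) ps → All (D ≢_) (restrict ps)
  restrict-≢ D []                   = []
  restrict-≢ D (_∷_ {x = p} D≢p ≢s) with dominating? G p
  ... | yes _ = D≢p ∘ cong set ∷ restrict-≢ D ≢s
  ... | no  _ = restrict-≢ D ≢s

  restrict-unique : ∀ {ps} → Unique ps → Unique (restrict ps)
  restrict-unique []                 = []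
  restrict-unique (_∷_ {x = p} ≢s u) with dominating? G p
  ... | yes d = restrict-≢ (p , d) ≢s ∷ restrict-unique u
  ... | no  _ = restrict-unique u

instance
  dominatingSet-finite : {G : SimpleGraph (Fin n)} → Finite (DominatingSet G)
  dominatingSet-finite {n} {G} = record
    { elements = restrict G (subsets n)
    ; unique   = restrict-unique G (subsets-unique n)
    ; complete = λ D → restrict-complete G D (subsets-complete (set D))
    }

{-# OPTIONS --safe #-}

-- The degree of a dominating set D in 𝒟 G is n minus the number of critical
-- vertices of D, those whose removal destroys domination.  Every vertex set has
-- an edge path to the full set, so being Eulerian amounts to n being even (the
-- degree of the full set) and every D having an even number of critical vertices.
--
-- If this holds, take a closed neighbourhood N w of least size and v ∈ N w.
-- In the complement of N w - v the vertex v is critical, so some x ≢ v is too,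
-- and by minimality N w - v + x is again a closed neighbourhood.  Taking v = w
-- gives a non-adjacent twin y of w; taking v = a adjacent to w gives a mate of a.
-- By connectedness N w and y exhaust the graph, so every vertex has
-- exactly one non-neighbour.
--
-- Conversely, in a cocktail party graph a set dominates iff it has at least two
-- elements, so a dominating set has no critical vertices or exactly two.

module Submission where

open import Defs
open import Data.Fin.Base using (Fin; zero; suc)
open import Data.Fin.Properties using (_≟_; any?; ¬∀⟶∃¬)
open import Data.Fin.Subset
  using (Subset; _∈_; _∉_; _⊆_; _∪_; _-_; ⁅_⁆; ∣_∣; ∁; ⊤; inside; outside)
open import Data.Fin.Subset.Properties
  using (_∈?_; x∈⁅x⁆; x∈⁅y⁆⇒x≡y; x∈p∪q⁺; x∈p∪q⁻; p─q⊆p; x∈p∧x≢y⇒x∈p-y;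
         x∈p⇒∣p-x∣<∣p∣; p⊆q⇒∣p∣≤∣q∣; p⊂q⇒∣p∣<∣q∣; x∉∁p⇒x∈p; x∈∁p⇒x∉p;
         x∉p⇒x∈∁p; ∈⊤; ⊆⊤; ⊆-antisym; ∪-identityʳ)
open import Data.List.Base using (List; []; _∷_; map; length; filter; allFin)
import Data.List.Extrema as Extrema
import Data.List.Membership.Propositional as List
open import Data.List.Membership.Propositional.Properties
  using (∈-allFin; ∈-filter⁺; ∈-filter⁻; ∈-map⁺; ∈-map⁻)
open import Data.List.Membership.Propositional.Properties.WithK using (unique∧set⇒bag)
open import Data.List.Properties using (filter-none; length-map; length-tabulate)
open import Data.List.Relation.Binary.BagAndSetEquality using (∼bag⇒↭)
open import Data.List.Relation.Binary.Permutation.Propositional.Properties using (↭-length)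
import Data.List.Relation.Unary.All as All
open import Data.List.Relation.Unary.All using ([]; _∷_)
open import Data.List.Relation.Unary.AllPairs using ([]; _∷_)
open import Data.List.Relation.Unary.Any using (here; there)
open import Data.List.Relation.Unary.Unique.Propositional using (Unique)
import Data.List.Relation.Unary.Unique.Propositional.Properties as Unique
open import Data.Nat.Base using (ℕ; zero; suc; _+_; _≤_; _<_; _≥_; z≤n; s≤s)
open import Data.Nat.Divisibility using (_∣_; _∣0; ∣1⇒≡1; ∣-refl; ∣m+n∣m⇒∣n; _∣?_)
open import Data.Nat.Properties
  using (≤-totalOrder; n≤1+n; ≤-refl; ≤-trans; <-≤-trans; n≮n; +-suc; +-comm; +-identityʳ)
open import Data.Product.Base using (∃-syntax; _×_; _,_; proj₁; proj₂)
open import Data.Sum.Base using (_⊎_; inj₁; inj₂; [_,_]′)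
open import Data.Vec.Base using ([]; _∷_; tabulate)
open import Data.Vec.Properties using ([]=⇒lookup; lookup⇒[]=; lookup∘tabulate)
open import Function.Base using (_∘_; id)
open import Function.Bundles using (_⇔_; mk⇔; Equivalence; Inverse)
open import Function.Construct.Identity using (↔-id)
open import Relation.Binary.Construct.Closure.ReflexiveTransitive
  using (ε; _◅_; _◅◅_; reverse)
open import Relation.Binary.PropositionalEquality
  using (_≡_; _≢_; refl; sym; trans; cong; subst; ≢-sym)
open import Relation.Nullary
  using (¬_; Dec; yes; no; does; ¬?; _×-dec_; _⊎-dec_; contradiction)
open import Relation.Nullary.Decidable using (dec-true; decidable-stable; from-no; recompute)
import Relation.Unary as Unary

open Equivalence using (to; from)

private
  variable
    n : ℕ

-- Counting with duplicate-free lists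

length-filter-¬ : {A : Set} {P : A → Set} (P? : Unary.Decidable P) (xs : List A) →
                  length (filter P? xs) + length (filter (¬? ∘ P?) xs) ≡ length xs
length-filter-¬ P? []       = refl
length-filter-¬ P? (x ∷ xs) with P? x
... | yes _ = cong suc (length-filter-¬ P? xs)
... | no  _ = trans (+-suc _ _) (cong suc (length-filter-¬ P? xs))

unique∧set⇒length : {A : Set} {xs ys : List A} → Unique xs → Unique ys →
                    (∀ {x} → x List.∈ xs ⇔ x List.∈ ys) → length xs ≡ length ys
unique∧set⇒length uxs uys eq = ↭-length (∼bag⇒↭ (unique∧set⇒bag uxs uys eq))

2∤1 : ¬ 2 ∣ 1
2∤1 2∣1 with () ← ∣1⇒≡1 2∣1

-- A non-empty list of even length has two leading entries; they are distinct, so at least one of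
-- them differs from `x`.
another-∈ : {xs : List (Fin n)} → Unique xs → 2 ∣ length xs →
            ∀ {x} → x List.∈ xs → ∃[ y ] y ≢ x × y List.∈ xs
another-∈ {xs = _ ∷ []} _ 2∣1 _ = contradiction 2∣1 2∤1
another-∈ {xs = a ∷ b ∷ _} ((a≢b ∷ _) ∷ _) _ {x} _ with a ≟ x
... | yes refl = b , ≢-sym a≢b , there (here refl)
... | no  a≢x  = a , a≢x , here refl

argmin : (f : Fin n → ℕ) → Fin n → ∃[ w ] (∀ u → f w ≤ f u)
argmin f x = Ext.argmin f x (allFin _) ,
  λ u → All.lookup (Ext.f[argmin]≤f[xs] {f = f} x (allFin _)) (∈-allFin u)
  where module Ext = Extrema ≤-totalOrder

-- Subsets and toggling of a vertex

fromPred : {P : Fin n → Set} → Unary.Decidable P → Subset n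
fromPred P? = tabulate (does ∘ P?)

∈-fromPred⁺ : {P : Fin n → Set} (P? : Unary.Decidable P) → ∀ {x} → P x → x ∈ fromPred P?
∈-fromPred⁺ P? {x} px =
  lookup⇒[]= x _ (trans (lookup∘tabulate (does ∘ P?) x) (dec-true (P? x) px))

∈-fromPred⁻ : {P : Fin n → Set} (P? : Unary.Decidable P) → ∀ {x} → x ∈ fromPred P? → P x
∈-fromPred⁻ P? {x} x∈
  with P? x | trans (sym (lookup∘tabulate (does ∘ P?) x)) ([]=⇒lookup x∈)
... | yes px | _ = px

∈-remove⁻ : ∀ {p : Subset n} {x y} → y ∈ p - x → y ∈ p × y ≢ x
∈-remove⁻ {p = p} {x} y∈ = p─q⊆p p ⁅ x ⁆ y∈ , λ { refl → x∉p-x p x y∈ }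

∣p∪⁅x⁆∣≤1+∣p∣ : ∀ (p : Subset n) x → ∣ p ∪ ⁅ x ⁆ ∣ ≤ suc ∣ p ∣
∣p∪⁅x⁆∣≤1+∣p∣ (inside  ∷ p) zero    rewrite ∪-identityʳ p = n≤1+n _
∣p∪⁅x⁆∣≤1+∣p∣ (outside ∷ p) zero    rewrite ∪-identityʳ p = ≤-refl
∣p∪⁅x⁆∣≤1+∣p∣ (inside  ∷ p) (suc x) = s≤s (∣p∪⁅x⁆∣≤1+∣p∣ p x)
∣p∪⁅x⁆∣≤1+∣p∣ (outside ∷ p) (suc x) = ∣p∪⁅x⁆∣≤1+∣p∣ p x

-- Symmetric difference with a singleton. It merges both cases of `OneVertexChange`, so that the
-- potential neighbours of `D` are indexed by vertices.
toggle : Subset n → Fin n → Subset n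
toggle D x with x ∈? D
... | yes _ = D - x
... | no  _ = D ∪ ⁅ x ⁆

∈-toggle⁺ : ∀ (D : Subset n) x {y} → y ≢ x → y ∈ D → y ∈ toggle D x
∈-toggle⁺ D x y≢x y∈D with x ∈? D
... | yes _ = x∈p∧x≢y⇒x∈p-y y∈D y≢x
... | no  _ = x∈p∪q⁺ (inj₁ y∈D)

∈-toggle⁻ : ∀ (D : Subset n) x {y} → y ≢ x → y ∈ toggle D x → y ∈ D
∈-toggle⁻ D x y≢x y∈ with x ∈? D
... | yes _ = proj₁ (∈-remove⁻ {p = D} y∈)
... | no  _ = [ id , (λ y∈x → contradiction (x∈⁅y⁆⇒x≡y x y∈x) y≢x) ]′ (x∈p∪q⁻ D ⁅ x ⁆ y∈)

self-∈-toggle⁺ : ∀ (D : Subset n) {x} → x ∉ D → x ∈ toggle D x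
self-∈-toggle⁺ D {x} x∉D with x ∈? D
... | yes x∈D = contradiction x∈D x∉D
... | no  _   = x∈p∪q⁺ (inj₂ (x∈⁅x⁆ x))

self-∈-toggle⁻ : ∀ (D : Subset n) {x} → x ∈ D → x ∉ toggle D x
self-∈-toggle⁻ D {x} x∈D with x ∈? D
... | yes _   = x∉p-x D x
... | no  x∉D = contradiction x∈D x∉D

-- Toggling `x` flips the membership of `x`, while toggling any other vertex preserves it.
toggle-injective : ∀ (D : Subset n) {x y} → toggle D x ≡ toggle D y → x ≡ y
toggle-injective D {x} {y} eq = decidable-stable (x ≟ y) λ x≢y →
  let x∉D : x ∉ D
      x∉D x∈D = self-∈-toggle⁻ D x∈D (subst (x ∈_) (sym eq) (∈-toggle⁺ D y x≢y x∈D))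
  in x∉D (∈-toggle⁻ D y x≢y (subst (x ∈_) eq (self-∈-toggle⁺ D x∉D)))

oneVertexChange⇔toggle : ∀ {D E : Subset n} → OneVertexChange D E ⇔ (∃[ x ] E ≡ toggle D x)
oneVertexChange⇔toggle {D = D} {E} = mk⇔ f g
  where
  f : OneVertexChange D E → ∃[ x ] E ≡ toggle D x
  f (x , change) = x , h change
    where
    h : x ∉ D × E ≡ D ∪ ⁅ x ⁆ ⊎ x ∈ D × E ≡ D - x → E ≡ toggle D x
    h change with x ∈? D | change
    ... | yes x∈D | inj₁ (x∉D , _) = contradiction x∈D x∉D
    ... | yes _   | inj₂ (_ , eq)  = eq
    ... | no  _   | inj₁ (_ , eq)  = eq
    ... | no  x∉D | inj₂ (x∈D , _) = contradiction x∈D x∉D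
  g : ∃[ x ] E ≡ toggle D x → OneVertexChange D E
  g (x , eq) with x ∈? D
  ... | yes x∈D = x , inj₂ (x∈D , eq)
  ... | no  x∉D = x , inj₁ (x∉D , eq)

-- Closed neighbourhoods and domination

module _ (G : SimpleGraph (Fin n)) where

  N? : ∀ u → Unary.Decidable (λ z → u ≡ z ⊎ Adj G u z)
  N? u z = (u ≟ z) ⊎-dec Adj? G u z

  -- The closed neighbourhood. A set dominates exactly when it meets every `N u`, the form in which
  -- domination is used below.
  N : Fin n → Subset n
  N u = fromPred (N? u)

  ∈N⁻ : ∀ {u z} → z ∈ N u → u ≡ z ⊎ Adj G u z
  ∈N⁻ {u} = ∈-fromPred⁻ (N? u)

  self∈N : ∀ u → u ∈ N u
  self∈N u = ∈-fromPred⁺ (N? u) (inj₁ refl)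

  adj⇒∈N : ∀ {u z} → Adj G u z → z ∈ N u
  adj⇒∈N {u} uz = ∈-fromPred⁺ (N? u) (inj₂ uz)

  ∈N⇒adj : ∀ {u z} → u ≢ z → z ∈ N u → Adj G u z
  ∈N⇒adj u≢z z∈ = [ (λ u≡z → contradiction u≡z u≢z) , id ]′ (∈N⁻ z∈)

  ∈N-sym : ∀ {u z} → z ∈ N u → u ∈ N z
  ∈N-sym z∈ with ∈N⁻ z∈
  ... | inj₁ refl = z∈
  ... | inj₂ uz   = adj⇒∈N (symm G uz)

  dominating⁺ : ∀ {D} → (∀ u → ∃[ z ] z ∈ N u × z ∈ D) → Dominating G D
  dominating⁺ meets v v∉D with z , z∈N , z∈D ← meets v =
    z , z∈D , ∈N⇒adj (λ { refl → v∉D z∈D }) z∈N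

  dominating⁻ : ∀ {D} → Dominating G D → ∀ u → ∃[ z ] z ∈ N u × z ∈ D
  dominating⁻ {D} dom u with u ∈? D
  ... | yes u∈D = u , self∈N u , u∈D
  ... | no  u∉D with z , z∈D , uz ← dom u u∉D = z , adj⇒∈N uz , z∈D

  meets? : ∀ (D : Subset n) u → Dec (∃[ z ] z ∈ N u × z ∈ D)
  meets? D u = any? λ z → (z ∈? N u) ×-dec (z ∈? D)

  ¬dominating⁻ : ∀ {D} → ¬ Dominating G D → ∃[ u ] (∀ {z} → z ∈ N u → z ∉ D)
  ¬dominating⁻ {D} ¬dom with u , ¬meets ← ¬∀⟶∃¬ n _ (meets? D) (¬dom ∘ dominating⁺) =
    u , λ z∈N z∈D → ¬meets (_ , z∈N , z∈D)

  dominating-⊆ : ∀ {D E} → D ⊆ E → Dominating G D → Dominating G E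
  dominating-⊆ D⊆E dom =
    dominating⁺ λ u → let z , z∈N , z∈D = dominating⁻ dom u in z , z∈N , D⊆E z∈D

  -- Critical vertices and degrees in `𝒟 G`

  Critical : Subset n → Fin n → Set
  Critical D x = ¬ Dominating G (toggle D x)

  -- Toggling a vertex outside `D` enlarges `D`, which preserves domination.
  critical⇒∈ : ∀ D x → Dominating G D → Critical D x → x ∈ D
  critical⇒∈ D x dom crit with x ∈? D
  ... | yes x∈D = x∈D
  ... | no  _   = contradiction (dominating-⊆ (x∈p∪q⁺ ∘ inj₁) dom) crit

  toggle-dominating? : ∀ D → Unary.Decidable (λ x → Dominating G (toggle D x))
  toggle-dominating? D x = dominating? G (toggle D x)

  criticals : Subset n → List (Fin n)
  criticals D = filter (¬? ∘ toggle-dominating? D) (allFin n)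

  ∈-criticals⁺ : ∀ D {x} → Critical D x → x List.∈ criticals D
  ∈-criticals⁺ D = ∈-filter⁺ (¬? ∘ toggle-dominating? D) (∈-allFin _)

  ∈-criticals⁻ : ∀ D {x} → x List.∈ criticals D → Critical D x
  ∈-criticals⁻ D = proj₂ ∘ ∈-filter⁻ (¬? ∘ toggle-dominating? D) {xs = allFin n}

  ∣criticals∣≡0 : ∀ D → (∀ x → ¬ Critical D x) → length (criticals D) ≡ 0
  ∣criticals∣≡0 D none = cong length
    (filter-none (¬? ∘ toggle-dominating? D) {xs = allFin n} (All.tabulate λ {x} _ → none x))

  criticals-unique : ∀ D → Unique (criticals D)
  criticals-unique D = Unique.filter⁺ (¬? ∘ toggle-dominating? D) (Unique.allFin⁺ n)

  -- The stored proof is irrelevant; decidability of domination recovers a usable one.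
  set-dominating : (D : DominatingSet G) → Dominating G (set D)
  set-dominating (D , dom) = recompute (dominating? G D) dom

  -- By injectivity of toggling, the neighbours of `D` are counted by the vertices whose toggling
  -- keeps domination; all remaining vertices are critical.
  degree+criticals : (D : DominatingSet G) →
                     degree (𝒟 G) D + length (criticals (set D)) ≡ n
  degree+criticals D =
    trans (cong (_+ length (criticals (set D))) degree≡)
      (trans (length-filter-¬ (toggle-dominating? (set D)) (allFin n)) (length-tabulate id))
    where
    neighbours : List (DominatingSet G)
    neighbours = filter (Adj? (𝒟 G) D) (Finite.elements dominatingSet-finite)

    removable : List (Fin n)
    removable = filter (toggle-dominating? (set D)) (allFin n)

    set-injective : {E F : DominatingSet G} → set E ≡ set F → E ≡ F
    set-injective {_ , _} {_ , _} refl = refl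

    neighbours⇔removable : ∀ {E} → E List.∈ map set neighbours ⇔
                                   E List.∈ map (toggle (set D)) removable
    neighbours⇔removable = mk⇔ f g
      where
      f : ∀ {E} → E List.∈ map set neighbours → E List.∈ map (toggle (set D)) removable
      f E∈ with F , F∈ , refl ← ∈-map⁻ set E∈
           with _ , D~F ← ∈-filter⁻ (Adj? (𝒟 G) D) {xs = Finite.elements dominatingSet-finite} F∈
           with x , eq ← to oneVertexChange⇔toggle D~F =
        subst (List._∈ _) (sym eq) (∈-map⁺ (toggle (set D))
          (∈-filter⁺ (toggle-dominating? (set D)) (∈-allFin x)
            (subst (Dominating G) eq (set-dominating F))))
      g : ∀ {E} → E List.∈ map (toggle (set D)) removable → E List.∈ map set neighbours
      g E∈ with x , x∈ , refl ← ∈-map⁻ (toggle (set D)) E∈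
           with _ , dom ← ∈-filter⁻ (toggle-dominating? (set D)) {xs = allFin n} x∈ =
        ∈-map⁺ set {x = toggle (set D) x , dom} (∈-filter⁺ (Adj? (𝒟 G) D)
          (Finite.complete dominatingSet-finite _) (from oneVertexChange⇔toggle (x , refl)))

    degree≡ : degree (𝒟 G) D ≡ length removable
    degree≡ = trans (sym (length-map set neighbours)) (trans
      (unique∧set⇒length
        (Unique.map⁺ set-injective
          (Unique.filter⁺ (Adj? (𝒟 G) D) (Finite.unique dominatingSet-finite)))
        (Unique.map⁺ (toggle-injective (set D))
          (Unique.filter⁺ (toggle-dominating? (set D)) (Unique.allFin⁺ n)))
        neighbours⇔removable)
      (length-map (toggle (set D)) removable))

  -- Connectedness of the dominating graph

  full : DominatingSet G
  full = ⊤ , λ v v∉⊤ → contradiction ∈⊤ v∉⊤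

  -- Missing vertices are added one at a time; every superset of a dominating set dominates.
  reachesFull : (D : DominatingSet G) → Reachable (𝒟 G) D full
  reachesFull D = go (allFin n) D (λ x → inj₂ (∈-allFin x))
    where
    -- Invariant: each vertex outside the current set is still in the list of vertices to process.
    go : ∀ xs (D : DominatingSet G) → (∀ x → x ∈ set D ⊎ x List.∈ xs) → Reachable (𝒟 G) D full
    go [] (D , dom) covers
      with refl ← ⊆-antisym (⊆⊤ {p = D}) (λ {x} _ → [ id , (λ ()) ]′ (covers x)) = ε
    go (x ∷ xs) (D , dom) covers with x ∈? D
    ... | yes x∈D = go xs (D , dom) λ y → case y (covers y)
      where
      case : ∀ y → y ∈ D ⊎ y List.∈ x ∷ xs → y ∈ D ⊎ y List.∈ xs
      case y (inj₁ y∈D)         = inj₁ y∈D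
      case y (inj₂ (here refl)) = inj₁ x∈D
      case y (inj₂ (there y∈))  = inj₂ y∈
    ... | no x∉D = (x , inj₁ (x∉D , refl)) ◅
                   go xs (D ∪ ⁅ x ⁆ , dominating-⊆ (x∈p∪q⁺ ∘ inj₁) dom) λ y → case y (covers y)
      where
      case : ∀ y → y ∈ D ⊎ y List.∈ x ∷ xs → y ∈ D ∪ ⁅ x ⁆ ⊎ y List.∈ xs
      case y (inj₁ y∈D)         = inj₁ (x∈p∪q⁺ (inj₁ y∈D))
      case y (inj₂ (here refl)) = inj₁ (x∈p∪q⁺ (inj₂ (x∈⁅x⁆ x)))
      case y (inj₂ (there y∈))  = inj₂ y∈

  𝒟-connected : Connected (𝒟 G)
  𝒟-connected D E = reachesFull D ◅◅ reverse (λ {u} {v} → symm (𝒟 G) {u} {v}) (reachesFull E)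

  -- Since `𝒟 G` is connected, any two components coincide and only the degree condition remains.
  eulerian⇔even : Eulerian (𝒟 G) ⇔ (∀ D → 2 ∣ degree (𝒟 G) D)
  eulerian⇔even = mk⇔ proj₁ λ even → even ,
    λ D E _ _ → (λ {F} _ → 𝒟-connected E F) , (λ {F} _ → 𝒟-connected D F)

-- Cocktail party graphs through mates

record Mates (G : SimpleGraph (Fin n)) : Set where
  field
    mate   : Fin n → Fin n
    mate≢  : ∀ u → mate u ≢ u
    adj⇔   : ∀ u v → Adj G u v ⇔ (u ≢ v × v ≢ mate u)

  -- Otherwise `mate u` would be adjacent to `u`, and by symmetry `u` to its own mate.
  mate-involutive : ∀ u → mate (mate u) ≡ u
  mate-involutive u = decidable-stable (mate (mate u) ≟ u) λ ≢u →
    let u~mate = symm G (from (adj⇔ (mate u) u) (mate≢ u , ≢-sym ≢u))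
    in proj₂ (to (adj⇔ u (mate u)) u~mate) refl

-- Forwards, matching partners are pulled back along the isomorphism. Backwards, the pairs `u`,
-- `mate u` form the matching and the isomorphism is the identity.
isCocktailParty⇔mates : {G : SimpleGraph (Fin n)} → IsCocktailParty G ⇔ Mates G
isCocktailParty⇔mates {n} {G} = mk⇔ f g
  where
  f : IsCocktailParty G → Mates G
  f (M , iso) = record
    { mate  = λ u → ψ (m (φ u))
    ; mate≢ = λ u eq → irrefl edges (sym (trans (sym (φψ (m (φ u)))) (cong φ eq))) (m-edge (φ u))
    ; adj⇔  = λ u v → mk⇔
        (λ uv → let φu≢φv , ¬edge = to (adjacency u v) uv in
          (λ { refl → φu≢φv refl }) ,
          (λ { refl → ¬edge (subst (Adj edges (φ u)) (sym (φψ _)) (m-edge (φ u))) }))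
        (λ (u≢v , v≢) → from (adjacency u v)
          ( (λ eq → u≢v (trans (sym (ψφ u)) (trans (cong ψ eq) (ψφ v))))
          , (λ edge → v≢ (trans (sym (ψφ v)) (cong ψ (sym (m-unique (φ u) edge)))))))
    }
    where
    open PerfectMatching M
    open _≅_ iso
    φ = Inverse.to bijection
    ψ = Inverse.from bijection
    φψ : ∀ v → φ (ψ v) ≡ v
    φψ = Inverse.strictlyInverseˡ bijection
    ψφ : ∀ v → ψ (φ v) ≡ v
    ψφ = Inverse.strictlyInverseʳ bijection
    m : Fin n → Fin n
    m v = proj₁ (perfect v)
    m-edge : ∀ v → Adj edges v (m v)
    m-edge v = proj₁ (proj₂ (perfect v))
    m-unique : ∀ v {w} → Adj edges v w → m v ≡ w
    m-unique v = proj₂ (proj₂ (perfect v))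

  g : Mates G → IsCocktailParty G
  g mates = matching , record { bijection = ↔-id _ ; adjacency = adj⇔ }
    where
    open Mates mates
    matching : PerfectMatching (complete n)
    matching = record
      { edges = λ where
          .Adj u v         → v ≡ mate u
          .Adj? u v        → v ≟ mate u
          .symm {u} refl   → sym (mate-involutive u)
          .irrefl {u} refl → ≢-sym (mate≢ u)
      ; subgraph = λ { {u} refl → ≢-sym (mate≢ u) }
      ; perfect  = λ u → mate u , refl , sym
      }

-- Critical vertices in a cocktail party graph

module _ {G : SimpleGraph (Fin n)} (mates : Mates G) where
  open Mates mates

  -- The vertex `mate x` is neither `x` nor adjacent to it.
  singleton-¬dominating : ∀ {D x} → (∀ {z} → z ∈ D → z ≡ x) → ¬ Dominating G D
  singleton-¬dominating {x = x} D⊆x dom with dominating⁻ G dom (mate x)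
  ... | z , z∈N , z∈D with refl ← D⊆x z∈D =
    proj₂ (to (adj⇔ x (mate x)) (∈N⇒adj G (≢-sym (mate≢ x)) (∈N-sym G z∈N))) refl

  -- Toggling `x` leaves some `N u` unmet. As `N u` omits only `mate u`, the set `D` lies within `x`
  -- and `mate u`; by `singleton-¬dominating` these differ and `mate u` belongs to `D`.
  critical⇒pair : ∀ D x → Dominating G D → Critical G D x →
                  ∃[ y ] y ≢ x × y ∈ D × (∀ {z} → z ∈ D → z ≡ x ⊎ z ≡ y)
  critical⇒pair D x dom crit with u , misses ← ¬dominating⁻ G crit =
    mate u , y≢x , y∈D , D⊆
    where
    D⊆ : ∀ {z} → z ∈ D → z ≡ x ⊎ z ≡ mate u
    D⊆ {z} z∈D with z ≟ x | z ≟ mate u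
    ... | yes z≡x | _       = inj₁ z≡x
    ... | no _    | yes z≡y = inj₂ z≡y
    ... | no z≢x  | no z≢y  = contradiction z∈toggle (misses z∈N)
      where
      z∈toggle : z ∈ toggle D x
      z∈toggle = ∈-toggle⁺ D x z≢x z∈D
      z∈N : z ∈ N G u
      z∈N with u ≟ z
      ... | yes refl = self∈N G u
      ... | no u≢z   = adj⇒∈N G (from (adj⇔ u z) (u≢z , z≢y))
    y≢x : mate u ≢ x
    y≢x y≡x = singleton-¬dominating (λ z∈D → [ id , (λ z≡y → trans z≡y y≡x) ]′ (D⊆ z∈D)) dom
    y∈D : mate u ∈ D
    y∈D = decidable-stable (mate u ∈? D) λ y∉D →
      singleton-¬dominating (λ z∈D → [ id , (λ { refl → contradiction z∈D y∉D }) ]′ (D⊆ z∈D)) dom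

  ∣criticals∣≡2 : ∀ D x → Dominating G D → Critical G D x → length (criticals G D) ≡ 2
  ∣criticals∣≡2 D x dom crit with y , y≢x , y∈D , D⊆ ← critical⇒pair D x dom crit =
    unique∧set⇒length {ys = x ∷ y ∷ []} (criticals-unique G D)
      ((≢-sym y≢x ∷ []) ∷ [] ∷ []) (mk⇔ f g)
    where
    y-critical : Critical G D y
    -- Removing `y` from the pair leaves at most `x`.
    y-critical = singleton-¬dominating λ {z} z∈ → case z∈ (z ≟ y)
      where
      case : ∀ {z} → z ∈ toggle D y → Dec (z ≡ y) → z ≡ x
      case z∈ (yes refl) = contradiction z∈ (self-∈-toggle⁻ D y∈D)
      case z∈ (no z≢y)   = [ id , (λ z≡y → contradiction z≡y z≢y) ]′ (D⊆ (∈-toggle⁻ D y z≢y z∈))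
    f : ∀ {z} → z List.∈ criticals G D → z List.∈ x ∷ y ∷ []
    f z∈ with D⊆ (critical⇒∈ G D _ dom (∈-criticals⁻ G D z∈))
    ... | inj₁ z≡x = here z≡x
    ... | inj₂ z≡y = there (here z≡y)
    g : ∀ {z} → z List.∈ x ∷ y ∷ [] → z List.∈ criticals G D
    g (here refl)         = ∈-criticals⁺ G D crit
    g (there (here refl)) = ∈-criticals⁺ G D y-critical

  2∣∣criticals∣ : ∀ D → Dominating G D → 2 ∣ length (criticals G D)
  2∣∣criticals∣ D dom with any? (¬? ∘ toggle-dominating? G D)
  ... | yes (x , crit) = subst (2 ∣_) (sym (∣criticals∣≡2 D x dom crit)) ∣-refl
  ... | no none = subst (2 ∣_) (sym (∣criticals∣≡0 G D λ x crit → none (x , crit))) (2 ∣0)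

  mates⇒even : 2 ∣ n → ∀ D → 2 ∣ degree (𝒟 G) D
  mates⇒even 2∣n D = ∣m+n∣m⇒∣n
    (subst (2 ∣_)
      (sym (trans (+-comm (length (criticals G (set D))) _) (degree+criticals G D))) 2∣n)
    (2∣∣criticals∣ (set D) (set-dominating G D))

-- Connected graphs and small orders

module _ {G : SimpleGraph (Fin n)} (connected : Connected G) (n≥2 : n ≥ 2) where

  -- The first edge of a path from `u` to some other vertex, which exists because `n ≥ 2`.
  neighbour : ∀ u → ∃[ v ] Adj G u v
  neighbour = go {G = G} n≥2 connected
    where
    step : ∀ {n} {G : SimpleGraph (Fin n)} {u w} → u ≢ w → Reachable G u w → ∃[ v ] Adj G u v
    step u≢w ε        = contradiction refl u≢w
    step u≢w (uv ◅ _) = _ , uv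
    go : ∀ {n} {G : SimpleGraph (Fin n)} → n ≥ 2 → Connected G → ∀ u → ∃[ v ] Adj G u v
    go {G = G} (s≤s (s≤s _)) conn zero    = step {G = G} (λ ()) (conn zero (suc zero))
    go {G = G} (s≤s (s≤s _)) conn (suc u) = step {G = G} (λ ()) (conn (suc u) zero)

-- On two vertices, a neighbour of `zero` would have to be the mate of `zero`; three is odd.
mates⇒n≥4 : {G : SimpleGraph (Fin n)} → Connected G → n ≥ 2 → 2 ∣ n → Mates G → n ≥ 4
mates⇒n≥4 {0} _ () _ _
mates⇒n≥4 {1} _ (s≤s ()) _ _
mates⇒n≥4 {2} {G} connected n≥2 _ record { mate≢ = mate≢ ; adj⇔ = adj⇔ }
  with v , 0v ← neighbour {G = G} connected n≥2 zero
  with 0≢v , v≢mate ← to (adj⇔ zero v) 0v =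
  contradiction (≢⇒≡suc _ (≢-sym 0≢v)) λ v≡1 →
    v≢mate (trans v≡1 (sym (≢⇒≡suc _ (mate≢ zero))))
  where
  ≢⇒≡suc : (i : Fin 2) → i ≢ zero → i ≡ suc zero
  ≢⇒≡suc zero       i≢0 = contradiction refl i≢0
  ≢⇒≡suc (suc zero) _   = refl
mates⇒n≥4 {3} _ _ 2∣3 _ = contradiction 2∣3 (from-no (2 ∣? 3))
mates⇒n≥4 {suc (suc (suc (suc _)))} _ _ _ _ = s≤s (s≤s (s≤s (s≤s z≤n)))

-- Parity consequences of even degrees

module _ {G : SimpleGraph (Fin n)} (connected : Connected G) (n≥2 : n ≥ 2)
         (even : ∀ D → 2 ∣ degree (𝒟 G) D) where

  -- Every vertex has a neighbour, so the full set has no critical vertex and its degree is `n`.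
  2∣n : 2 ∣ n
  2∣n = subst (2 ∣_) (trans (sym (+-identityʳ _))
          (trans (cong (degree (𝒟 G) (full G) +_) (sym ∣criticals∣≡0-⊤))
            (degree+criticals G (full G))))
          (even (full G))
    where
    removable : ∀ x → Dominating G (toggle ⊤ x)
    removable x v v∉ with v ≟ x | neighbour {G = G} connected n≥2 v
    ... | no v≢x   | _      = contradiction (∈-toggle⁺ ⊤ x v≢x ∈⊤) v∉
    ... | yes refl | u , vu = u , ∈-toggle⁺ ⊤ x (λ { refl → irrefl G refl vu }) ∈⊤ , vu
    ∣criticals∣≡0-⊤ : length (criticals G ⊤) ≡ 0
    ∣criticals∣≡0-⊤ = ∣criticals∣≡0 G ⊤ λ x crit → crit (removable x)

  -- With `n` and all degrees even, the number of critical vertices is even, hence never one.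
  another-critical : ∀ D x → Dominating G D → Critical G D x → ∃[ y ] y ≢ x × Critical G D y
  another-critical D x dom crit
    with y , y≢x , y∈ ← another-∈ (criticals-unique G D)
           (∣m+n∣m⇒∣n (subst (2 ∣_) (sym (degree+criticals G (D , dom))) 2∣n) (even (D , dom)))
           (∈-criticals⁺ G D crit) = y , y≢x , ∈-criticals⁻ G D y∈

  -- Exchange in a least closed neighbourhood

  Least : Fin n → Set
  Least w = ∀ u → ∣ N G w ∣ ≤ ∣ N G u ∣

  module Exchange {w v} (least : Least w) (v∈N : v ∈ N G w) where

    -- The set `D` is chosen to meet `N G w` in `v` alone.
    P D : Subset n
    P = N G w - v
    D = ∁ P

    ∣P∣<∣N∣ : ∣ P ∣ < ∣ N G w ∣
    ∣P∣<∣N∣ = x∈p⇒∣p-x∣<∣p∣ v∈N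

    -- A closed neighbourhood missed by `D` would lie inside `P`, which is smaller than the least
    -- one.
    D-dominating : Dominating G D
    D-dominating = dominating⁺ G λ u → decidable-stable (meets? G D u) λ ¬meets →
      n≮n _ (<-≤-trans ∣P∣<∣N∣ (≤-trans (least u)
        (p⊆q⇒∣p∣≤∣q∣ λ z∈N → x∉∁p⇒x∈p λ z∈D → ¬meets (_ , z∈N , z∈D))))

    v∈D : v ∈ D
    v∈D = x∉p⇒x∈∁p (x∉p-x (N G w) v)

    v-critical : Critical G D v
    v-critical dom with z , z∈N , z∈ ← dominating⁻ G dom w with z ≟ v
    ... | yes refl = self-∈-toggle⁻ D v∈D z∈
    ... | no z≢v   = x∈∁p⇒x∉p (∈-toggle⁻ D v z≢v z∈) (x∈p∧x≢y⇒x∈p-y z∈N z≢v)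

    module _ {x} (x≢v : x ≢ v) (x-critical : Critical G D x)
             {u} (misses : ∀ {z} → z ∈ N G u → z ∉ toggle D x) where

      x∉N : x ∉ N G w
      x∉N x∈N = x∈∁p⇒x∉p (critical⇒∈ G D x D-dominating x-critical) (x∈p∧x≢y⇒x∈p-y x∈N x≢v)

      Q : Subset n
      Q = P ∪ ⁅ x ⁆

      ∣Q∣≤∣N∣ : ∣ Q ∣ ≤ ∣ N G w ∣
      ∣Q∣≤∣N∣ = ≤-trans (∣p∪⁅x⁆∣≤1+∣p∣ P x) ∣P∣<∣N∣

      N⊆Q : N G u ⊆ Q
      N⊆Q {z} z∈N with z ≟ x
      ... | yes refl = x∈p∪q⁺ (inj₂ (x∈⁅x⁆ x))
      ... | no z≢x   = x∈p∪q⁺ (inj₁ (x∉∁p⇒x∈p λ z∈D → misses z∈N (∈-toggle⁺ D x z≢x z∈D)))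

      -- If `N G u` were strictly inside `Q`, it would be smaller than `N G w`, contradicting
      -- leastness.
      Q⊆N : Q ⊆ N G u
      Q⊆N {z} z∈Q = decidable-stable (z ∈? N G u) λ z∉N →
        n≮n _ (<-≤-trans (p⊂q⇒∣p∣<∣q∣ (N⊆Q , z , z∈Q , z∉N)) (≤-trans ∣Q∣≤∣N∣ (least u)))

      u-least : Least u
      u-least t = ≤-trans (p⊆q⇒∣p∣≤∣q∣ N⊆Q) (≤-trans ∣Q∣≤∣N∣ (least t))

      ⇒ : ∀ {z} → z ∈ N G u → z ≡ x ⊎ z ∈ N G w × z ≢ v
      ⇒ z∈ with x∈p∪q⁻ P ⁅ x ⁆ (N⊆Q z∈)
      ... | inj₁ z∈P = inj₂ (∈-remove⁻ {p = N G w} z∈P)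
      ... | inj₂ z∈x = inj₁ (x∈⁅y⁆⇒x≡y x z∈x)

      ⇐ : ∀ {z} → z ≡ x ⊎ z ∈ N G w × z ≢ v → z ∈ N G u
      ⇐ (inj₁ refl)        = Q⊆N (x∈p∪q⁺ (inj₂ (x∈⁅x⁆ x)))
      ⇐ (inj₂ (z∈N , z≢v)) = Q⊆N (x∈p∪q⁺ (inj₁ (x∈p∧x≢y⇒x∈p-y z∈N z≢v)))

    -- Unfolding this in the with-clauses below makes type checking very slow.
    abstract
      exchange : ∃[ u ] ∃[ x ] x ∉ N G w × Least u ×
                 (∀ {z} → z ∈ N G u ⇔ (z ≡ x ⊎ z ∈ N G w × z ≢ v))
      exchange
        with x , x≢v , x-critical ← another-critical D v D-dominating v-critical
        with u , misses ← ¬dominating⁻ G x-critical =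
        u , x , x∉N x≢v x-critical misses , u-least x≢v x-critical misses ,
        mk⇔ (⇒ x≢v x-critical misses) (⇐ x≢v x-critical misses)

  open Exchange using (exchange)

  -- Exchanging `w` itself gives some `N G u` without `w`. By symmetry `u` is outside `N G w`, so
  -- `u` is the vertex gained.
  twin : ∀ {w} → Least w →
         ∃[ y ] y ∉ N G w × (∀ {z} → z ∈ N G y ⇔ (z ≡ y ⊎ z ∈ N G w × z ≢ w))
  twin {w} least with u , x , x∉N , _ , N⇔ ← exchange least (self∈N G w)
                 with to N⇔ (self∈N G u)
  ... | inj₁ refl        = x , x∉N , N⇔
  ... | inj₂ (u∈N , u≢w) with to N⇔ (∈N-sym G u∈N)
  ...   | inj₁ refl      = contradiction (self∈N G w) x∉N
  ...   | inj₂ (_ , w≢w) = contradiction refl w≢w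

  -- Every vertex has exactly one non-neighbour

  module _ {w y} (least : Least w) (y∉N : y ∉ N G w)
           (Ny⇔ : ∀ {z} → z ∈ N G y ⇔ (z ≡ y ⊎ z ∈ N G w × z ≢ w)) where

    private
      -- The candidate for the whole vertex set.
      U : Fin n → Set
      U z = z ≡ y ⊎ z ∈ N G w

    -- Exchanging a yields some N b, and the vertex gained is y.  The twin of b is
    -- then a, the only vertex of N w outside N b, so a and b have the same neighbours.
    neighbour-mate : ∀ {a} → a ∈ N G w → a ≢ w →
                     ∃[ b ] (∀ {z} → z ∈ N G a ⇔ (z ≢ b × U z))
    neighbour-mate {a} a∈N a≢w
      with b , x , x∉N , b-least , Nb⇔ ← exchange least a∈N
      with w∈Nb ← from Nb⇔ (inj₂ (self∈N G w , ≢-sym a≢w))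
      -- The gained vertex `x` lies in `N G b` but not in `N G w`.
      with b≢w ← (λ { refl → x∉N (from Nb⇔ (inj₁ refl)) })
      -- Here `b` is a neighbour of `w`, hence of the twin `y`; so `y` lies in `N G b` and, being
      -- outside `N G w`, is the vertex gained.
      with to Nb⇔ (∈N-sym G (from (Ny⇔ {b}) (inj₂ (∈N-sym G w∈Nb , b≢w))))
    ... | inj₂ (y∈N , _) = contradiction y∈N y∉N
    ... | inj₁ refl
      with t , t∉Nb , Nt⇔ ← twin b-least
      with t ≟ a
    -- The twin `t` of `b` is adjacent to `w`, so it would survive the exchange into `N G b` unless
    -- it were `a`.
    ...   | no t≢a = contradiction
        (from Nb⇔ (inj₂ (∈N-sym G (from Nt⇔ (inj₂ (w∈Nb , ≢-sym b≢w))) , t≢a))) t∉Nb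
    ...   | yes refl = b , mk⇔ ⇒ ⇐
      where
      ⇒ : ∀ {z} → z ∈ N G a → z ≢ b × U z
      ⇒ z∈ with to Nt⇔ z∈
      ... | inj₁ refl = (λ { refl → t∉Nb (self∈N G b) }) , inj₂ a∈N
      ... | inj₂ (z∈Nb , z≢b) with to Nb⇔ z∈Nb
      ...   | inj₁ z≡y       = z≢b , inj₁ z≡y
      ...   | inj₂ (z∈N , _) = z≢b , inj₂ z∈N
      ⇐ : ∀ {z} → z ≢ b × U z → z ∈ N G a
      ⇐ {z} (z≢b , Uz) with z ≟ a
      ... | yes refl = self∈N G a
      ... | no z≢a = from Nt⇔ (inj₂ (from Nb⇔ ([ inj₁ , (λ z∈N → inj₂ (z∈N , z≢a)) ]′ Uz) , z≢b))

    -- Neighbours of `y` are controlled by `Ny⇔`, those of `w` by definition, and all others by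
    -- `neighbour-mate`.
    U-closed : ∀ {u v} → U u → Adj G u v → U v
    U-closed (inj₁ refl) uv with to Ny⇔ (adj⇒∈N G uv)
    ... | inj₁ v≡y       = inj₁ v≡y
    ... | inj₂ (v∈N , _) = inj₂ v∈N
    U-closed {u} (inj₂ u∈N) uv with u ≟ w
    ... | yes refl = inj₂ (adj⇒∈N G uv)
    ... | no u≢w   = proj₂ (to (proj₂ (neighbour-mate u∈N u≢w)) (adj⇒∈N G uv))

    U-universal : ∀ u → U u
    U-universal u = go (inj₂ (self∈N G w)) (connected w u)
      where
      go : ∀ {u v} → U u → Reachable G u v → U v
      go Uu ε         = Uu
      go Uu (uv ◅ vw) = go (U-closed Uu uv) vw

    -- The vertices `w` and `y` miss each other; any other vertex misses the `b` of
    -- `neighbour-mate`.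
    unique-nonneighbour : ∀ u → ∃[ m ] (∀ {z} → z ∈ N G u ⇔ z ≢ m)
    unique-nonneighbour u with U-universal u | u ≟ w
    ... | _ | yes refl = y , λ {z} → mk⇔ (λ { z∈N refl → y∉N z∈N })
              (λ z≢y → [ (λ z≡y → contradiction z≡y z≢y) , id ]′ (U-universal z))
    ... | inj₁ refl | no y≢w = w , λ {z} → mk⇔
              (λ z∈ → [ (λ { refl → y≢w }) , proj₂ ]′ (to Ny⇔ z∈))
              (λ z≢w → from Ny⇔ ([ inj₁ , (λ z∈N → inj₂ (z∈N , z≢w)) ]′ (U-universal z)))
    ... | inj₂ u∈N | no u≢w with b , Nu⇔ ← neighbour-mate u∈N u≢w =
      b , λ {z} → mk⇔ (proj₁ ∘ to Nu⇔) (λ z≢b → from Nu⇔ (z≢b , U-universal z))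

  even⇒mates : Mates G
  even⇒mates = record
    { mate  = λ u → proj₁ (nonneighbour u)
    ; mate≢ = λ u m≡u → to (proj₂ (nonneighbour u)) (self∈N G u) (sym m≡u)
    ; adj⇔  = λ u v → mk⇔
        (λ uv → (λ u≡v → irrefl G u≡v uv) , to (proj₂ (nonneighbour u)) (adj⇒∈N G uv))
        (λ (u≢v , v≢m) → ∈N⇒adj G u≢v (from (proj₂ (nonneighbour u)) v≢m))
    }
    where
    nonneighbour : ∀ u → ∃[ m ] (∀ {z} → z ∈ N G u ⇔ z ≢ m)
    nonneighbour u =
      let w , least     = argmin (λ v → ∣ N G v ∣) u
          y , y∉N , Ny⇔ = twin least
      in unique-nonneighbour least y∉N Ny⇔ u

theorem7 : (n : ℕ) → n ≥ 2 → (G : SimpleGraph (Fin n)) → Connected G →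
    Eulerian (𝒟 G) ⇔ (2 ∣ n × n ≥ 4 × IsCocktailParty G)
theorem7 n n≥2 G connected = mk⇔
  (λ eulerian →
    let even   = to (eulerian⇔even G) eulerian
        n-even = 2∣n {G = G} connected n≥2 even
        mates  = even⇒mates connected n≥2 even
    in n-even , mates⇒n≥4 connected n≥2 n-even mates , from isCocktailParty⇔mates mates)
  (λ (n-even , _ , cocktail) →
    from (eulerian⇔even G) (mates⇒even (to isCocktailParty⇔mates cocktail) n-even))
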